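{- Let $D=(Q,F,q_0,\Sigma,\delta)$ be a deterministic finite automaton and let $M=\mathrm{BuildOFA}(D)$ be the offsetting finite automaton constructed from $D$ as described in the context. Then $M$ accepts the same language as $D$: for every string $s\in\Sigma^*$, $M$ matches $s$ if and only if $\delta(q_0,s)\in F$.
   Context: DFA: finite state set $Q$, finite nonempty alphabet $\Sigma$, initial state $q_0$, final states $F\subseteq Q$, total transition function $\delta:Q\times\Sigma\to Q$, extended to strings by $\delta(q,\varepsilon)=q$, $\delta(q,c+t)=\delta(\delta(q,c),t)$. Strings are indexed from $0$: $s=s[0]s[1]\cdots s[len(s)-1]$. Offsetting finite automaton (OFA): a set of states $Q_M$, final states $F_M\subseteq Q_M$, an initial state $q0_M\in Q_M$, a transition function $\delta_M:Q_M\times\Sigma\to Q_M$, an index offset function $\Theta:Q_M\times\Sigma\to\mathbb Z$, and a position offset function $\Phi:F_M\cup\{q0_M\}\to\mathbb Z$. Its action on a string $s$ is defined by iteration: $\Delta(\langle q,i\rangle,s)=\Delta(\langle\delta_M(q,s[i]),\,i+\Theta(q,s[i])\rangle,s)$ if $0\le i<len(s)$, and $\Delta(\langle q,i\rangle,s)=\langle q,i\rangle$ otherwise. The OFA matches $s$ when $\langle q',i'\rangle=\Delta(\langle q0_M,\Phi(q0_M)\rangle,s)$ satisfies $q'\in F_M$ and $i'-\Phi(q')=len(s)$. Tries: a trie is a finite tree that is either a leaf $T$, carrying a state $state(T)\in Q$, or a trie node $T$, having exactly one child trie $child(T,c)$ for each $c\in\Sigma$. A trie is compressible if it is a trie node,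 all its children are leaves, and these leaves all carry the same state. $level(T')$ is the distance of a node $T'$ from the root of its trie. Construction of $M=\mathrm{BuildOFA}(D)$: (1) $\mathrm{EvolveAndCompress}(T,c)$: if $T$ is a leaf, return a leaf with state $\delta(state(T),c)$. If $T$ is a trie node, form the trie node $T'$ with $child(T',x)=\mathrm{EvolveAndCompress}(child(T,x),c)$ for each $x\in\Sigma$; if $T'$ is compressible return one of its (equal) leaf children, otherwise return $T'$. (2) $\mathrm{GrowTrie}(T)$: the trie node with $child(\cdot,c)=\mathrm{EvolveAndCompress}(T,c)$ for each $c\in\Sigma$ (this root is not itself compressed). (3) $\mathrm{BuildTrie}(q)$: start with $T=\mathrm{GrowTrie}(\text{leaf with state }q)$ and $g=1$. While no leaf of $T$ carries a state in $F$ and a budget function $\mathrm{BudgetAllowsBiggerTrie}(q,T,g)$ returns true, replace $T$ by $\mathrm{GrowTrie}(T)$ and $g$ by $g+1$. The budget function is a customizable Boolean function for which this loop terminates for every $q$ (for instance "$g<12$"). The result is the trie $T_q$ and the lookahead $look(q)=g\ge 1$. The tries $T_q$, $q\in Q$, are disjoint, i.e. nodes of different tries are distinct objects. (4) For each trie node $T'$ of a trie $T_q$ and each $c\in\Sigma$, with $T''=child(T',c)$: put $offset(T',c)=-1$ if $T''$ is a trie node, and $offset(T',c)=level(T')+look(state(T''))$ if $T''$ is a leaf. (5) Every transition to a leaf $T''$ is then redirected to the root of $T_{state(T'')}$. (6) $q0_M$ is the root of $T_{q_0}$; $Q_M$ is the set of trie nodes reachable from $q0_M$ through the redirected child maps;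 $F_M$ is the set of those roots of $T_q$ with $q\in F$ that lie in $Q_M$; $\delta_M(T',c)=child(T',c)$ (after redirection); $\Theta(T',c)=offset(T',c)$; and $\Phi(\text{root of }T_q)=look(q)-1$ wherever $\Phi$ is required to be defined. -}

module Defs where

open import Data.Bool using (Bool; true; false)
open import Data.Fin using (Fin; toℕ)
open import Data.Fin.Properties using (all?; inj⇒≟)
open import Data.Integer using (ℤ; +_; 0ℤ; 1ℤ; -1ℤ; _+_; _-_; _≤_; _<_)
open import Data.List using (List; []; _∷_; length; lookup)
open import Data.Nat using (ℕ; suc)
open import Data.Product using (∃; _×_; _,_; proj₁; proj₂)
open import Data.Sum using (_⊎_; inj₁; inj₂; map₁)
open import Function.Bundles using (_↔_; Inverse)
open import Function.Properties.Inverse using (↔⇒↣)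
open import Level using (0ℓ)
open import Relation.Binary.Definitions using (DecidableEquality)
open import Relation.Binary.PropositionalEquality using (_≡_; refl; sym; trans; cong; subst)
open import Relation.Nullary using (¬_; Dec; yes; no)
open import Relation.Nullary.Decidable using (map′)
open import Relation.Unary using (Pred; Decidable)

Finite : Set → Set
Finite A = ∃ λ n → A ↔ Fin n

record DFA : Set₁ where
  field
    Q          : Set
    Q-finite   : Finite Q
    Σ          : Set
    Σ-finite   : Finite Σ
    Σ-nonempty : Σ
    q₀         : Q
    F          : Pred Q 0ℓ
    F?         : Decidable F
    δ          : Q → Σ → Q

  δ* : Q → List Σ → Q
  δ* q []      = q
  δ* q (c ∷ t) = δ* (δ q c) t

  _≟Q_ : DecidableEquality Q
  _≟Q_ = inj⇒≟ (↔⇒↣ (proj₂ Q-finite))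

  allΣ? : {P : Pred Σ 0ℓ} → Decidable P → Dec (∀ c → P c)
  allΣ? {P} P? = map′
    (λ h c → subst P (strictlyInverseʳ c) (h (to c)))
    (λ h i → h (from i))
    (all? (λ i → P? (from i)))
    where open Inverse (proj₂ Σ-finite)

record OFA (Σ : Set) : Set₁ where
  field
    Q  : Set
    F  : Pred Q 0ℓ
    q0 : Q
    δ  : Q → Σ → Q
    Θ  : Q → Σ → ℤ
    -- The proof of membership in the domain F ∪ {q0} is irrelevant, so the
    -- offset of a state cannot depend on it.
    Φ  : (q : Q) → .(F q ⊎ q ≡ q0) → ℤ

  Config : Set
  Config = Q × ℤ

  -- s ⊢ x ⇓ y  means that the iteration defining Δ(x , s) terminates, with
  -- result y; Δ is only a partial function for a general OFA.
  data _⊢_⇓_ (s : List Σ) : Config → Config → Set where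
    step : ∀ {q i y} (j : Fin (length s)) → i ≡ + toℕ j →
           s ⊢ (δ q (lookup s j) , i + Θ q (lookup s j)) ⇓ y →
           s ⊢ (q , i) ⇓ y
    halt : ∀ {q i} → ¬ (0ℤ ≤ i × i < + length s) →
           s ⊢ (q , i) ⇓ (q , i)

  Matches : List Σ → Set
  Matches s = ∃ λ q′ → ∃ λ i′ → ∃ λ (f : F q′) →
    s ⊢ (q0 , Φ q0 (inj₂ refl)) ⇓ (q′ , i′) × i′ - Φ q′ (inj₁ f) ≡ + length s

module Tries (D : DFA) where
  open DFA D

  mutual
    data Trie : Set where
      leaf : Q → Trie
      node : TrieNode → Trie

    -- A trie node is given by its children.
    TrieNode : Set
    TrieNode = Σ → Trie

  Compressible : Pred TrieNode 0ℓ
  Compressible T = ∃ λ q → ∀ c → T c ≡ leaf q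

  leaf-injective : ∀ {p q} → leaf p ≡ leaf q → p ≡ q
  leaf-injective refl = refl

  isLeaf? : ∀ q T → Dec (T ≡ leaf q)
  isLeaf? q (leaf p) = map′ (cong leaf) leaf-injective (p ≟Q q)
  isLeaf? q (node _) = no λ ()

  compressible? : Decidable Compressible
  compressible? T with T Σ-nonempty in eq
  ... | leaf q = map′ (q ,_) same (allΣ? (λ c → isLeaf? q (T c)))
    where
    same : Compressible T → ∀ c → T c ≡ leaf q
    same (p , h) c = trans (h c) (trans (sym (h Σ-nonempty)) eq)
  ... | node _ = no λ (p , h) → node≢leaf (trans (sym eq) (h Σ-nonempty))
    where
    node≢leaf : ∀ {U p} → ¬ (node U ≡ leaf p)
    node≢leaf ()

  compress : TrieNode → Trie
  compress T with compressible? T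
  ... | yes (q , _) = leaf q
  ... | no _        = node T

  evolveAndCompress : Trie → Σ → Trie
  evolveAndCompress (leaf q) c = leaf (δ q c)
  evolveAndCompress (node T) c = compress (λ x → evolveAndCompress (T x) c)

  growTrie : Trie → TrieNode
  growTrie T c = evolveAndCompress T c

  data SomeLeaf (P : Pred Q 0ℓ) : Trie → Set where
    here  : ∀ {q} → P q → SomeLeaf P (leaf q)
    below : ∀ {T} c → SomeLeaf P (T c) → SomeLeaf P (node T)

  module Loop (budgetAllows : Q → Trie → ℕ → Bool) where

    -- The while loop of BuildTrie(q) terminates when entered with trie node T
    -- and lookahead g.
    data Terminates (q : Q) (T : TrieNode) (g : ℕ) : Set where
      exit  : SomeLeaf F (node T) ⊎ budgetAllows q (node T) g ≡ false →
              Terminates q T g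
      again : ¬ SomeLeaf F (node T) → budgetAllows q (node T) g ≡ true →
              Terminates q (growTrie (node T)) (suc g) →
              Terminates q T g

    loop : ∀ {q T g} → Terminates q T g → TrieNode × ℕ
    loop {T = T} {g = g} (exit _) = T , g
    loop (again _ _ t)            = loop t

  record Budget : Set where
    field
      budgetAllowsBiggerTrie : Q → Trie → ℕ → Bool
    open Loop budgetAllowsBiggerTrie public
    field
      terminates : ∀ q → Terminates q (growTrie (leaf q)) 1

  -- The occurrences of trie nodes in a trie, i.e. its trie nodes as distinct
  -- objects (equal subtries at different places are different nodes).
  data NodeOf : Trie → Set where
    root  : ∀ {T} → NodeOf (node T)
    below : ∀ {T} c → NodeOf (T c) → NodeOf (node T)

  level : ∀ {T} → NodeOf T → ℕ
  level root        = 0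
  level (below _ n) = suc (level n)

  top : ∀ T → NodeOf T ⊎ Q
  top (leaf q) = inj₂ q
  top (node _) = inj₁ root

  -- inj₁: the child is a trie node; inj₂: the child is a leaf with this state.
  child : ∀ {T} → NodeOf T → Σ → NodeOf T ⊎ Q
  child (root {T})  c = map₁ (below c) (top (T c))
  child (below d n) c = map₁ (below d) (child n c)

module Build (D : DFA) (B : Tries.Budget D) where
  open DFA D
  open Tries D
  open Budget B

  trie : Q → TrieNode
  trie q = proj₁ (loop (terminates q))

  look : Q → ℕ
  look q = proj₂ (loop (terminates q))

  -- A node together with the state q whose trie T_q it belongs to.
  Node : Set
  Node = ∃ λ q → NodeOf (node (trie q))

  rootOf : Q → Node
  rootOf q = q , root

  redirectedChild : Node → Σ → Node
  redirectedChild (q , n) c with child n c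
  ... | inj₁ n′ = q , n′
  ... | inj₂ q′ = rootOf q′

  offset : Node → Σ → ℤ
  offset (q , n) c with child n c
  ... | inj₁ _  = -1ℤ
  ... | inj₂ q′ = + level n + + look q′

  data Reachable : Pred Node 0ℓ where
    start : Reachable (rootOf q₀)
    next  : ∀ {n} → Reachable n → ∀ c → Reachable (redirectedChild n c)

  -- Irrelevance of the second field makes this a subset of Node: states with
  -- the same node are equal.
  record State : Set where
    constructor ⟨_,_⟩
    field
      nodeOf     : Node
      .reachable : Reachable nodeOf
  open State public

buildOFA : (D : DFA) → Tries.Budget D → OFA (DFA.Σ D)
buildOFA D B = record
  { Q  = State
  ; F  = λ x → ∃ λ q → F q × nodeOf x ≡ rootOf q
  ; q0 = ⟨ rootOf q₀ , start ⟩
  ; δ  = λ { ⟨ n , r ⟩ c → ⟨ redirectedChild n c , next r c ⟩ }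
  ; Θ  = λ x c → offset (nodeOf x) c
    -- The domain of Φ consists of roots of tries T_q only.
  ; Φ  = λ x _ → + look (proj₁ (nodeOf x)) - 1ℤ
  }
  where
  open DFA D using (F; q₀)
  open Build D B

{-# OPTIONS --safe #-}
-- Write g for the lookahead of q.  The trie T_q reads a word of length g
-- backwards: the path labelled x₁ ⋯ x_d ends in a leaf p only if δ*(q , v) = p
-- for every word v of length g whose last d letters are x_d ⋯ x₁.  Hence, if M
-- is at the root of T_q and at position |u| + g - 1, where q = δ*(q₀ , u) and
-- s = u v w with |v| = g, it moves left inside v until it meets a leaf, whose
-- state is δ*(q₀ , uv), and the offset then takes it to the same situation for
-- uv.  If fewer than g letters follow u, M halts at once and matches iff u = s
-- and q is final.  This is correct when u ≠ s too, since the loop would have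
-- stopped before reaching g if a shorter nonempty word led from q to F.
module Submission where

open import Defs
open import Data.Bool using (Bool)
open import Data.Empty using (⊥-elim)
open import Data.Fin using (Fin; toℕ; zero; suc)
open import Data.Fin.Properties using (toℕ<n; toℕ-injective)
open import Data.Integer using (ℤ; +_; 0ℤ; 1ℤ; -1ℤ; _+_; _-_; _≤_; _<_; +≤+; +<+)
import Data.Integer.Properties as ℤ
open import Algebra.Properties.AbelianGroup ℤ.+-0-abelianGroup using (//-rightDividesʳ)
open import Data.Integer.Solver using (module +-*-Solver)
open import Data.List using (List; []; _∷_; _++_; length; lookup; reverse; take; drop; _ʳ++_)
open import Data.List.Properties
  using (++-assoc; length-++; length-reverse; length-take; length-drop;
         length-ʳ++; reverse-involutive; take++drop≡id; ʳ++-defn)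
open import Data.Nat as ℕ using (ℕ; suc; s≤s; z≤n)
open import Data.Nat.Induction using (Acc; acc; <-wellFounded)
import Data.Nat.Properties as ℕ
open import Data.Product using (∃; _×_; _,_; proj₁; proj₂)
open import Data.Sum using (_⊎_; inj₁; inj₂; map₁; [_,_]′)
open import Function.Bundles using (_⇔_; mk⇔; Equivalence)
open import Relation.Binary.PropositionalEquality
  using (_≡_; refl; sym; trans; cong; cong₂; subst; module ≡-Reasoning)
open import Relation.Nullary using (¬_; yes; no)

-- Auxiliary facts on lists.

length≡0⇒≡[] : ∀ {A : Set} (xs : List A) → length xs ≡ 0 → xs ≡ []
length≡0⇒≡[] [] _ = refl

ʳ++-++-assoc : ∀ {A : Set} (v : List A) {t w} → v ʳ++ (t ++ w) ≡ (v ʳ++ t) ++ w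
ʳ++-++-assoc []      = refl
ʳ++-++-assoc (_ ∷ v) = ʳ++-++-assoc v

lookup-++-∷ : ∀ {A : Set} (u : List A) {c w} →
  ∃ λ (j : Fin (length (u ++ c ∷ w))) → toℕ j ≡ length u × lookup (u ++ c ∷ w) j ≡ c
lookup-++-∷ []      = zero , refl , refl
lookup-++-∷ (_ ∷ u) = let j , j≡ , c≡ = lookup-++-∷ u in suc j , cong suc j≡ , c≡

-- Runs of an arbitrary offsetting automaton.

module _ {A : Set} (M : OFA A) where
  open OFA M

  ⇓-deterministic : ∀ {s x y z} → s ⊢ x ⇓ y → s ⊢ x ⇓ z → y ≡ z
  ⇓-deterministic (step j refl d) (step k j≡k e)
    with refl ← toℕ-injective (ℤ.+-injective j≡k) = ⇓-deterministic d e
  ⇓-deterministic (step j refl _) (halt ¬range) =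
    ⊥-elim (¬range (+≤+ z≤n , +<+ (toℕ<n j)))
  ⇓-deterministic (halt ¬range) (step j refl _) =
    ⊥-elim (¬range (+≤+ z≤n , +<+ (toℕ<n j)))
  ⇓-deterministic (halt _) (halt _) = refl

  Accepting : List A → Config → Set
  Accepting s (q , i) = ∃ λ (f : F q) → i - Φ q (inj₁ f) ≡ + length s

  -- Bundles termination with the acceptance criterion. It passes backwards along a step, so a run
  -- can be treated from its end.
  HaltsWith : List A → Set → Config → Set
  HaltsWith s P x = ∃ λ y → s ⊢ x ⇓ y × (Accepting s y ⇔ P)

  -- Determinism identifies the run hidden in `Matches s` with the given one.
  haltsWith⇒matches⇔ : ∀ {s P} → HaltsWith s P (q0 , Φ q0 (inj₂ refl)) → Matches s ⇔ P
  haltsWith⇒matches⇔ {s} (y , d , e) = mk⇔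
    (λ (q , i , f , d′ , i≡) →
      Equivalence.to e (subst (Accepting s) (⇓-deterministic d′ d) (f , i≡)))
    (λ p → let f , i≡ = Equivalence.from e p in _ , _ , f , d , i≡)

  step-++-∷ : ∀ {s P q i} u {c w} → s ≡ u ++ c ∷ w → i ≡ + length u →
    HaltsWith s P (δ q c , i + Θ q c) → HaltsWith s P (q , i)
  step-++-∷ {s} {q = q} {i} u refl refl (y , d , e) =
    let j , j≡ , c≡ = lookup-++-∷ u
    in y , step j (cong +_ (sym j≡))
             (subst (λ c → s ⊢ (δ q c , i + Θ q c) ⇓ y) (sym c≡) d) , e

-- Tries as predictors of the state reached.

module _ (D : DFA) where
  open DFA D renaming (Σ to Letter)
  open Tries D

  δ*-++ : ∀ q u v → δ* q (u ++ v) ≡ δ* (δ* q u) v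
  δ*-++ q []      v = refl
  δ*-++ q (c ∷ u) v = δ*-++ (δ q c) u v

  -- T correctly predicts δ* q on the words that consist of n unread letters
  -- followed by t; the unread letters are listed last first.
  data Predicts (q : Q) : Trie → ℕ → List Letter → Set where
    leaf : ∀ {p n t} → (∀ v → length v ≡ n → δ* q (v ʳ++ t) ≡ p) →
           Predicts q (leaf p) n t
    node : ∀ {T n t} → (∀ c → Predicts q (T c) n (c ∷ t)) →
           Predicts q (node T) (suc n) t

  leafState : ∀ {q p n t} → Predicts q (leaf p) n t →
    ∀ v → length v ≡ n → δ* q (v ʳ++ t) ≡ p
  leafState (leaf h) = h

  predicts-compress : ∀ {q T n t} → Predicts q (node T) (suc n) t →
    Predicts q (compress T) (suc n) t
  predicts-compress {T = T} h with compressible? T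
  predicts-compress h        | no _ = h
  predicts-compress {q} {T} {n} {t} (node h) | yes (p , T≡) = leaf λ where
      -- The list is nonempty as its length is `suc n`; whichever letter `c` heads it, the child at
      -- `c` is `leaf p`.
      (c ∷ v) v≡ → leafState (subst (λ U → Predicts q U n (c ∷ t)) (T≡ c) (h c))
                     v (ℕ.suc-injective v≡)

  -- The appended letter `c` ends the word, so it joins the letters already read; the unread ones
  -- stay the same.
  predicts-evolve : ∀ {q T n t} → Predicts q T n t →
    ∀ c → Predicts q (evolveAndCompress T c) n (t ++ c ∷ [])
  predicts-evolve {q} {t = t} (leaf {p} h) c = leaf λ v v≡ → begin
      δ* q (v ʳ++ (t ++ c ∷ []))  ≡⟨ cong (δ* q) (ʳ++-++-assoc v) ⟩
      δ* q ((v ʳ++ t) ++ c ∷ [])  ≡⟨ δ*-++ q (v ʳ++ t) (c ∷ []) ⟩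
      δ (δ* q (v ʳ++ t)) c        ≡⟨ cong (λ x → δ x c) (h v v≡) ⟩
      δ p c                       ∎
    where
    open ≡-Reasoning
  predicts-evolve (node h) c = predicts-compress (node λ x → predicts-evolve (h x) c)

  predicts-grow : ∀ {q T n} → Predicts q T n [] → Predicts q (node (growTrie T)) (suc n) []
  predicts-grow h = node λ c → predicts-evolve h c

  -- The word itself, followed from its last unread letter, selects the leaf.
  final-leaf : ∀ {q T n t} → Predicts q T n t →
    ∀ v → length v ≡ n → F (δ* q (v ʳ++ t)) → SomeLeaf F T
  final-leaf (leaf h) v       v≡ f = here (subst F (h v v≡) f)
  final-leaf (node h) (c ∷ v) v≡ f = below c (final-leaf (h c) v (ℕ.suc-injective v≡) f)

  -- The empty word is excluded because `q` itself may be final.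
  NotFinalBelow : Q → ℕ → Set
  NotFinalBelow q g = ∀ v → 0 ℕ.< length v → length v ℕ.< g → ¬ F (δ* q v)

  module _ (budgetAllows : Q → Trie → ℕ → Bool) where
    open Loop budgetAllows

    -- In `again` no leaf is final, which settles words of length exactly `g`; shorter ones are
    -- covered by the invariant.
    loop-correct : ∀ {q T g} (t : Terminates q T g) →
      Predicts q (node T) g [] → NotFinalBelow q g →
      Predicts q (node (proj₁ (loop t))) (proj₂ (loop t)) [] × NotFinalBelow q (proj₂ (loop t))
    loop-correct (exit _) h nf = h , nf
    loop-correct {q} {T} {g} (again noLeaf _ t) h nf =
      loop-correct t (predicts-grow h) λ v 0< v<sg →
        [ nf v 0< , notFinal v ]′ (ℕ.m≤n⇒m<n∨m≡n (ℕ.≤-pred v<sg))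
      where
      notFinal : ∀ v → length v ≡ g → ¬ F (δ* q v)
      -- `final-leaf` takes the unread letters last first, hence `reverse`.
      notFinal v v≡ f = noLeaf (final-leaf h (reverse v) (trans (length-reverse v) v≡)
        (subst (λ w → F (δ* q w)) (sym (reverse-involutive v)) f))

  -- Node occurrences and their children.

  subtrie : ∀ {T} → NodeOf T → TrieNode
  subtrie (root {T})  = T
  subtrie (below _ n) = subtrie n

  -- Being indexed by the outcome of `child`, it lets `move` abstract `child n c` and still keep the
  -- equations about the subtrie.
  data Locates {T} (U : Trie) (k : ℕ) : NodeOf T ⊎ Q → Set where
    inner : ∀ n → U ≡ node (subtrie n) → level n ≡ k → Locates U k (inj₁ n)
    outer : ∀ p → U ≡ leaf p → Locates U k (inj₂ p)

  top-locates : ∀ U → Locates U 0 (top U)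
  top-locates (leaf p) = outer p refl
  top-locates (node T) = inner root refl refl

  below-locates : ∀ {T U k} c {x} → Locates {T c} U k x →
    Locates {node T} U (suc k) (map₁ (below c) x)
  below-locates c (inner n U≡ k≡) = inner (below c n) U≡ (cong suc k≡)
  below-locates c (outer p U≡)    = outer p U≡

  child-locates : ∀ {T} (n : NodeOf T) c →
    Locates (subtrie n c) (suc (level n)) (child n c)
  child-locates (root {T})  c = below-locates c (top-locates (T c))
  child-locates (below d n) c = below-locates d (child-locates n c)

  -- Movement of the built automaton through a block.

  module _ (B : Budget) where
    open Budget B
    open Build D B

    private
      M : OFA Letter
      M = buildOFA D B

    trie-correct : ∀ q → Predicts q (node (trie q)) (look q) [] × NotFinalBelow q (look q)
    trie-correct q = loop-correct budgetAllowsBiggerTrie (terminates q)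
      (predicts-grow (leaf λ { [] _ → refl }))
      (λ v 0< <1 _ → ℕ.<⇒≱ 0< (ℕ.≤-pred <1))

    look≡suc : ∀ q → ∃ λ k → look q ≡ suc k
    look≡suc q = positive (proj₁ (trie-correct q))
      where
      positive : ∀ {T n t} → Predicts q (node T) n t → ∃ λ k → n ≡ suc k
      positive (node _) = _ , refl

    -- The position of the last letter of the block starting at `b`. The summand in parentheses is
    -- `Φ` of the root, so subtracting `Φ` returns `b`.
    rootPosition : ℕ → Q → ℤ
    rootPosition b q = + b + (+ look q - 1ℤ)

    rootPosition≡ : ∀ b {q k} → look q ≡ suc k → rootPosition b q ≡ + (b ℕ.+ k)
    rootPosition≡ b look≡ rewrite look≡ = refl

    offset-inner : ∀ b m → + (b ℕ.+ suc m) + -1ℤ ≡ + (b ℕ.+ m)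
    offset-inner b m rewrite ℕ.+-suc b m = refl

    -- The head is at `b + m` after reading `suc d` letters of a block that starts at `b`, so the
    -- next block starts at `b + m + suc d`.
    offset-leaf : ∀ b m d l →
      + (b ℕ.+ m) + (+ d + + l) ≡ + (b ℕ.+ (m ℕ.+ suc d)) + (+ l - 1ℤ)
    offset-leaf b m d l = begin
      + b + + m + (+ d + + l)
        ≡⟨ solve 4 (λ b m d l → b :+ m :+ (d :+ l) :=
                      b :+ (m :+ (con 1ℤ :+ d)) :+ (l :- con 1ℤ)) refl (+ b) (+ m) (+ d) (+ l) ⟩
      + b + (+ m + + suc d) + (+ l - 1ℤ) ∎
      where
      open ≡-Reasoning
      open +-*-Solver

    move : ∀ q (n : NodeOf (node (trie q))) c →
      (∃ λ n′ → subtrie n c ≡ node (subtrie n′) × level n′ ≡ suc (level n) ×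
        redirectedChild (q , n) c ≡ (q , n′) × offset (q , n) c ≡ -1ℤ) ⊎
      (∃ λ p → subtrie n c ≡ leaf p ×
        redirectedChild (q , n) c ≡ rootOf p × offset (q , n) c ≡ + level n + + look p)
    move q n c with child n c | child-locates n c
    ... | _ | inner n′ U≡ l≡ = inj₁ (n′ , U≡ , l≡ , refl , refl)
    ... | _ | outer p U≡     = inj₂ (p , U≡ , refl , refl)

    -- The reachability proof is generalised since its type mentions the node
    -- that is rewritten.
    haltsWith-cong : ∀ {s P n n′ i i′} .{r : Reachable n} → n ≡ n′ → i ≡ i′ →
      (∀ .(r′ : Reachable n′) → HaltsWith M s P (⟨ n′ , r′ ⟩ , i′)) →
      HaltsWith M s P (⟨ n , r ⟩ , i)
    haltsWith-cong {r = r} refl refl h = h r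

    -- u is the word before the current block, v the unread letters of the
    -- block (last first), t its letters already read, and w what follows it.
    descend : ∀ {s P q} u w {m t} (n : NodeOf (node (trie q))) .(r : Reachable (q , n)) →
      Predicts q (node (subtrie n)) (suc m) t → level n ≡ length t →
      ∀ v → length v ≡ suc m → s ≡ u ++ (v ʳ++ (t ++ w)) →
      (∀ p → δ* q (v ʳ++ t) ≡ p → .(r′ : Reachable (rootOf p)) →
        HaltsWith M s P (⟨ rootOf p , r′ ⟩ , rootPosition (length (u ++ (v ʳ++ t))) p)) →
      HaltsWith M s P (⟨ (q , n) , r ⟩ , + (length u ℕ.+ m))
    descend {s} {P} {q} u w {m} {t} n r (node h) l≡ (c ∷ v) v≡ s≡ cont =
      step-++-∷ M (u ++ reverse v) split (cong +_ (sym position)) afterMove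
      where
      i : ℤ
      i = + (length u ℕ.+ m)

      v≡m : length v ≡ m
      v≡m = ℕ.suc-injective v≡

      split : s ≡ (u ++ reverse v) ++ c ∷ (t ++ w)
      split = trans s≡ (trans (cong (u ++_) (ʳ++-defn v)) (sym (++-assoc u (reverse v) _)))

      position : length (u ++ reverse v) ≡ length u ℕ.+ m
      position = trans (length-++ u) (cong (length u ℕ.+_) (trans (length-reverse v) v≡m))

      blockEnd : length u ℕ.+ (m ℕ.+ suc (level n)) ≡ length (u ++ (v ʳ++ (c ∷ t)))
      blockEnd = sym (trans (length-++ u) (cong (length u ℕ.+_)
        (trans (length-ʳ++ v) (cong₂ ℕ._+_ v≡m (cong suc (sym l≡))))))

      afterMove : HaltsWith M s P
        (⟨ redirectedChild (q , n) c , next r c ⟩ , i + offset (q , n) c)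
      afterMove with move q n c
      ... | inj₂ (p , T≡ , n≡ , o≡) = haltsWith-cong n≡
        (trans (cong (_+_ i) o≡) (trans (offset-leaf (length u) m (level n) (look p))
          (cong (λ b → rootPosition b p) blockEnd)))
        (cont p (leafState (subst (λ U → Predicts q U m (c ∷ t)) T≡ (h c)) v v≡m))
      ... | inj₁ (n′ , T≡ , l′≡ , n≡ , o≡)
        with subst (λ U → Predicts q U m (c ∷ t)) T≡ (h c)
      -- A node predicts only with letters left to read: `m` becomes `suc k`, so moving left stays
      -- inside the block.
      ... | h′@(node {n = k} _) = haltsWith-cong n≡
        (trans (cong (_+_ i) o≡) (offset-inner (length u) k))
        (λ r′ → descend u w n′ r′ h′ (trans l′≡ (cong suc l≡)) v v≡m s≡ cont)

    -- Correctness at the roots of tries.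

    module _ (s : List Letter) where

      Good : State × ℤ → Set
      Good = HaltsWith M s (F (δ* q₀ s))

      halt-at-root : ∀ q u w → s ≡ u ++ w → δ* q₀ u ≡ q → length w ℕ.< look q →
        .(r : Reachable (rootOf q)) → Good (⟨ rootOf q , r ⟩ , rootPosition (length u) q)
      halt-at-root q u w s≡ q≡ w<look r = _ , halt outside , accepting⇔
        where
        open OFA M using (halt)

        outside : ¬ (0ℤ ≤ rootPosition (length u) q × rootPosition (length u) q < + length s)
        outside (_ , <s) with look q | look≡suc q
        ... | _ | k , refl = ℕ.<⇒≱ (ℤ.drop‿+<+ <s) (begin
          length s              ≡⟨ trans (cong length s≡) (length-++ u) ⟩
          length u ℕ.+ length w ≤⟨ ℕ.+-monoʳ-≤ (length u) (ℕ.≤-pred w<look) ⟩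
          length u ℕ.+ k        ∎)
          where open ℕ.≤-Reasoning

        δ*s≡ : δ* q₀ s ≡ δ* q w
        δ*s≡ = trans (cong (δ* q₀) s≡) (trans (δ*-++ q₀ u w) (cong (λ x → δ* x w) q≡))

        accepting⇔ : Accepting M s (⟨ rootOf q , r ⟩ , rootPosition (length u) q) ⇔ F (δ* q₀ s)
        accepting⇔ = mk⇔ to from
          where
          Φq : ℤ
          Φq = + look q - 1ℤ

          |s|≡ : length s ≡ length u ℕ.+ length w
          |s|≡ = trans (cong length s≡) (length-++ u)

          to : Accepting M s (⟨ rootOf q , r ⟩ , rootPosition (length u) q) → F (δ* q₀ s)
          to ((_ , f , n≡) , i≡) = subst F (sym (trans δ*s≡ (cong (δ* q) w≡[])))
              (subst F (sym (cong proj₁ n≡)) f)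
            where
            |u|≡|s| : length u ≡ length s
            |u|≡|s| = ℤ.+-injective (trans (sym (//-rightDividesʳ Φq (+ length u))) i≡)

            w≡[] : w ≡ []
            w≡[] = length≡0⇒≡[] w (ℕ.+-cancelˡ-≡ (length u) _ 0
              (trans (sym (trans |u|≡|s| |s|≡)) (sym (ℕ.+-identityʳ _))))

          from : F (δ* q₀ s) → Accepting M s (⟨ rootOf q , r ⟩ , rootPosition (length u) q)
          from f with length w ℕ.≟ 0
          -- A nonempty remainder shorter than `look q` cannot lead from `q` to `F`.
          ... | no w≢0 = ⊥-elim (proj₂ (trie-correct q) w (ℕ.n≢0⇒n>0 w≢0) w<look (subst F δ*s≡ f))
          ... | yes w≡0 = (q , subst F (trans δ*s≡ (cong (δ* q) (length≡0⇒≡[] w w≡0))) f , refl)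
            , trans (//-rightDividesʳ Φq (+ length u)) (cong +_ (sym
                (trans |s|≡ (trans (cong (length u ℕ.+_) w≡0) (ℕ.+-identityʳ _)))))

      -- Recursion on the length of `w`: each block removes `look q` letters, a positive number.
      root-good : ∀ q u w → Acc ℕ._<_ (length w) → s ≡ u ++ w → δ* q₀ u ≡ q →
        .(r : Reachable (rootOf q)) → Good (⟨ rootOf q , r ⟩ , rootPosition (length u) q)
      root-good q u w (acc rec) s≡ q≡ r with length w ℕ.<? look q
      ... | yes w<look = halt-at-root q u w s≡ q≡ w<look r
      ... | no  w≮look = let k , look≡ = look≡suc q in
        subst (λ i → Good (⟨ rootOf q , r ⟩ , i)) (sym (rootPosition≡ (length u) look≡))
          (descend u rest root r
            (subst (λ g → Predicts q (node (trie q)) g []) look≡ (proj₁ (trie-correct q)))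
            refl (reverse v) (trans (length-reverse v) (trans |v|≡g look≡)) s≡u++v++rest
            λ p p≡ r′ → root-good p _ rest (rec rest<w) s≡uv++rest (uv≡ p p≡) r′)
        where
        g : ℕ
        g = look q

        v rest : List Letter
        v    = take g w
        rest = drop g w

        g≤w : g ℕ.≤ length w
        g≤w = ℕ.≮⇒≥ w≮look

        |v|≡g : length v ≡ g
        |v|≡g = trans (length-take g w) (ℕ.m≤n⇒m⊓n≡m g≤w)

        s≡u++v++rest : s ≡ u ++ (reverse v ʳ++ rest)
        s≡u++v++rest = trans s≡ (cong (u ++_) (sym (trans (ʳ++-defn (reverse v))
          (trans (cong (_++ rest) (reverse-involutive v)) (take++drop≡id g w)))))

        s≡uv++rest : s ≡ (u ++ reverse (reverse v)) ++ rest
        s≡uv++rest = trans s≡u++v++rest (trans (cong (u ++_) (ʳ++-defn (reverse v)))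
          (sym (++-assoc u _ rest)))

        uv≡ : ∀ p → δ* q (reverse (reverse v)) ≡ p → δ* q₀ (u ++ reverse (reverse v)) ≡ p
        uv≡ p p≡ = trans (δ*-++ q₀ u _) (trans (cong (λ x → δ* x (reverse (reverse v))) q≡) p≡)

        rest<w : length rest ℕ.< length w
        rest<w = subst (ℕ._< length w) (sym (length-drop g w))
          (ℕ.∸-monoʳ-< (subst (0 ℕ.<_) (sym (proj₂ (look≡suc q))) (s≤s z≤n)) g≤w)

mainTheorem1 : (D : DFA) (B : Tries.Budget D) (s : List (DFA.Σ D)) →
    OFA.Matches (buildOFA D B) s ⇔ DFA.F D (DFA.δ* D (DFA.q₀ D) s)
mainTheorem1 D B s = haltsWith⇒matches⇔ (buildOFA D B)
  -- For empty `u` the position is `0` plus `Φ` of the initial state.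
  (subst (λ i → HaltsWith M s _ (OFA.q0 M , i)) (ℤ.+-identityˡ _)
    (root-good D B s (DFA.q₀ D) [] s (<-wellFounded _) refl refl Build.start))
  where M = buildOFA D B
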